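{- For all integers $n>3$, we have $b_{3,2}(n)\geq b_{2,2}(n)$.
   Context: A partition of a positive integer $n$ is a finite non-increasing sequence of positive integers $\lambda=(\lambda_1,\lambda_2,\ldots,\lambda_r)$ with $\lambda_1+\cdots+\lambda_r=n$. The Young diagram of $\lambda$ is the left-justified array of boxes whose $i$-th row from the top has $\lambda_i$ boxes. The hook length of a box in a Young diagram is the number of boxes directly to its right (in the same row) plus the number of boxes directly below it (in the same column) plus $1$ (for the box itself). For an integer $t\geq 2$, a $t$-regular partition of $n$ is a partition of $n$ none of whose parts is divisible by $t$. For integers $t\geq 2$ and $k\geq 1$, $b_{t,k}(n)$ denotes the number of hooks of length $k$ in all the $t$-regular partitions of $n$, i.e. the sum over all $t$-regular partitions $\lambda$ of $n$ of the number of boxes in the Young diagram of $\lambda$ with hook length equal to $k$. -}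

module Defs where

open import Data.List.Base using (List; []; _∷_; _++_; map; filter; length; upTo)
open import Data.List.Membership.Propositional using (_∈_)
open import Data.List.Membership.Propositional.Properties
  using (∈-++⁺ˡ; ∈-++⁺ʳ; ∈-map⁺; ∈-map⁻; ∈-filter⁺; ∈-filter⁻)
open import Data.List.Relation.Unary.All using (All; []; _∷_; all?; lookup) renaming (map to mapAll)
import Data.List.Relation.Unary.All.Properties as All
open import Data.List.Relation.Unary.Any using (here)
open import Data.List.Relation.Unary.AllPairs using ([]; _∷_)
open import Data.List.Relation.Unary.Linked using (Linked; linked?)
open import Data.List.Relation.Unary.Unique.Propositional using (Unique)
import Data.List.Relation.Unary.Unique.Propositional.Properties as Unique
open import Data.Nat.Base using (ℕ; zero; suc; _+_; _<_; _≥_; _>_; z<s)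
open import Data.Nat.Divisibility using (_∣_; _∣?_)
open import Data.Nat.ListAction using (sum)
open import Data.Nat.Properties using (_≟_; _<?_; _≥?_; _>?_; suc-injective)
open import Data.Product.Base using (_×_; _,_; map₁; proj₂)
open import Relation.Binary.PropositionalEquality using (_≡_; refl)
open import Relation.Nullary using (¬_; Dec; ¬?; _×-dec_)

IsPartition : ℕ → List ℕ → Set
IsPartition n ps = Linked _≥_ ps × All (_> 0) ps × sum ps ≡ n

IsRegular : ℕ → List ℕ → Set
IsRegular t ps = All (λ p → ¬ (t ∣ p)) ps

IsRegularPartition : ℕ → ℕ → List ℕ → Set
IsRegularPartition t n ps = IsPartition n ps × IsRegular t ps

isRegularPartition? : ∀ t n ps → Dec (IsRegularPartition t n ps)
isRegularPartition? t n ps =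
  (linked? _≥?_ ps ×-dec all? (_>? 0) ps ×-dec (sum ps ≟ n))
    ×-dec all? (λ p → ¬? (t ∣? p)) ps

-- A box is a pair (row , column), both counted from 0, with row 0 at the top.
Box : Set
Box = ℕ × ℕ

youngDiagram : List ℕ → List Box
youngDiagram []       = []
youngDiagram (p ∷ ps) = map (0 ,_) (upTo p) ++ map (map₁ suc) (youngDiagram ps)

RightOf : Box → Box → Set
RightOf (i , j) (i′ , j′) = i′ ≡ i × j < j′

Below : Box → Box → Set
Below (i , j) (i′ , j′) = i < i′ × j′ ≡ j

rightOf? : ∀ b b′ → Dec (RightOf b b′)
rightOf? (i , j) (i′ , j′) = (i′ ≟ i) ×-dec (j <? j′)

below? : ∀ b b′ → Dec (Below b b′)
below? (i , j) (i′ , j′) = (i <? i′) ×-dec (j′ ≟ j)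

hookLength : List ℕ → Box → ℕ
hookLength ps b =
  length (filter (rightOf? b) (youngDiagram ps)) +
  length (filter (below? b) (youngDiagram ps)) + 1

hooksOfLength : ℕ → List ℕ → ℕ
hooksOfLength k ps = length (filter (λ b → hookLength ps b ≟ k) (youngDiagram ps))

incrementHead : List ℕ → List ℕ
incrementHead []       = []
incrementHead (p ∷ ps) = suc p ∷ ps

-- All finite sequences of positive integers with sum n, in any order: for
-- n ≥ 2 the first part is either 1 or one more than the first part of a
-- composition of n - 1.
compositions : ℕ → List (List ℕ)
compositions 0             = [] ∷ []
compositions 1             = (1 ∷ []) ∷ []
compositions (suc (suc n)) =
  map (1 ∷_) (compositions (suc n)) ++ map incrementHead (compositions (suc n))

-- Lists every t-regular partition of n exactly once; see ∈-regularPartitions⁺,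
-- ∈-regularPartitions⁻ and regularPartitions-unique below.
regularPartitions : ℕ → ℕ → List (List ℕ)
regularPartitions t n = filter (isRegularPartition? t n) (compositions n)

b : (t k n : ℕ) → ℕ
b t k n = sum (map (hooksOfLength k) (regularPartitions t n))

∈-compositions⁺ : ∀ n ps → All (_> 0) ps → sum ps ≡ n → ps ∈ compositions n
∈-compositions⁺ 0 [] _ _ = here refl
∈-compositions⁺ 0 (zero ∷ _) (() ∷ _) _
∈-compositions⁺ 1 (1 ∷ []) _ _ = here refl
∈-compositions⁺ 1 (1 ∷ zero ∷ _) (_ ∷ () ∷ _) _
∈-compositions⁺ (suc n) (zero ∷ _) (() ∷ _) _
∈-compositions⁺ (suc (suc n)) (1 ∷ ps) (_ ∷ pos) eq =
  ∈-++⁺ˡ (∈-map⁺ (1 ∷_) (∈-compositions⁺ (suc n) ps pos (suc-injective eq)))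
∈-compositions⁺ (suc (suc n)) (suc (suc p) ∷ ps) (_ ∷ pos) eq =
  ∈-++⁺ʳ (map (1 ∷_) (compositions (suc n)))
    (∈-map⁺ incrementHead
      (∈-compositions⁺ (suc n) (suc p ∷ ps) (z<s ∷ pos) (suc-injective eq)))

compositions-positive : ∀ n → All (All (_> 0)) (compositions n)
compositions-positive 0 = [] ∷ []
compositions-positive 1 = (z<s ∷ []) ∷ []
compositions-positive (suc (suc n)) =
  All.++⁺ (All.map⁺ (mapAll (z<s ∷_) (compositions-positive (suc n))))
          (All.map⁺ (mapAll incrementHead-positive (compositions-positive (suc n))))
  where
  incrementHead-positive : ∀ {ps} → All (_> 0) ps → All (_> 0) (incrementHead ps)
  incrementHead-positive []        = []
  incrementHead-positive (_ ∷ pos) = z<s ∷ pos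

compositions-unique : ∀ n → Unique (compositions n)
compositions-unique 0 = [] ∷ []
compositions-unique 1 = [] ∷ []
compositions-unique (suc (suc n)) =
  Unique.++⁺ (Unique.map⁺ ∷-injective (compositions-unique (suc n)))
             (Unique.map⁺ incrementHead-injective (compositions-unique (suc n)))
             disjoint
  where
  ∷-injective : ∀ {ps qs : List ℕ} → 1 ∷ ps ≡ 1 ∷ qs → ps ≡ qs
  ∷-injective refl = refl

  incrementHead-injective : ∀ {ps qs} → incrementHead ps ≡ incrementHead qs → ps ≡ qs
  incrementHead-injective {[]}    {[]}    refl = refl
  incrementHead-injective {_ ∷ _} {_ ∷ _} refl = refl

  disjoint : ∀ {ps} → ¬ (ps ∈ map (1 ∷_) (compositions (suc n)) ×
                         ps ∈ map incrementHead (compositions (suc n)))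
  disjoint (l , r) with ∈-map⁻ (1 ∷_) l | ∈-map⁻ incrementHead r
  ... | _ , _ , refl | zero ∷ _ , qs∈ , refl with lookup (compositions-positive (suc n)) qs∈
  ...   | () ∷ _

∈-regularPartitions⁺ : ∀ t n {ps} → IsRegularPartition t n ps → ps ∈ regularPartitions t n
∈-regularPartitions⁺ t n {ps} reg@((_ , pos , eq) , _) =
  ∈-filter⁺ (isRegularPartition? t n) (∈-compositions⁺ n ps pos eq) reg

∈-regularPartitions⁻ : ∀ t n {ps} → ps ∈ regularPartitions t n → IsRegularPartition t n ps
∈-regularPartitions⁻ t n ps∈ =
  proj₂ (∈-filter⁻ (isRegularPartition? t n) {xs = compositions n} ps∈)

regularPartitions-unique : ∀ t n → Unique (regularPartitions t n)
regularPartitions-unique t n =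
  Unique.filter⁺ (isRegularPartition? t n) (compositions-unique n)

{-# OPTIONS --safe #-}
module Submission where

-- In a partition λ the hooks of length 2 correspond to the parts p ≥ 2 with p - 1 ∉ λ
-- and to the parts of multiplicity at least 2. Let O(n) and R(n) count the 2-regular and
-- the 3-regular partitions of n. Deleting p, or p twice, gives
--   b 2 2 n = Σ O(n - p) (p ≥ 3 odd)  +  Σ O(n - 2p) (p odd),
-- and for 3-regular partitions, replacing the parts p + 1, p by p, p, 1 when p ≡ 1 mod 3,
--   b 3 2 n ≥ Σ (R(n - (3i+2)) + R(n - (3i+4)) + R(n - (6i+4))) (i ≥ 0).
-- Replacing the k-th odd number 2k - 1 by the k-th non-multiple of 3, for each part other
-- than 1, and adjusting the number of 1s shows O(N) ≤ R(N') whenever N ≤ N' + 1. The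
-- offsets on the first line are therefore matched injectively with those on the second,
-- none increasing except 3 ↦ 4, which is where n > 3 is needed.

open import Defs
open import Data.List.Base
  using (List; []; _∷_; _++_; [_]; map; filter; length; upTo; replicate)
open import Data.List.Membership.DecPropositional using () renaming (_∈?_ to member?)
open import Data.List.Membership.Propositional using (_∈_; _∉_; lose)
open import Data.List.Membership.Propositional.Properties
  using (∈-++⁺ˡ; ∈-++⁺ʳ; ∈-++⁻; ∈-filter⁺; ∈-filter⁻; ∈-∃++; ∈-map⁺; ∈-map⁻)
open import Data.List.Properties
  using (filter-++; filter-≐; filter-none; filter-accept; filter-reject; filter-some; length-++;
    length-map; upTo-∷ʳ)
open import Data.List.Relation.Binary.Permutation.Propositional as Perm
  using (_↭_; ↭-refl; ↭-sym; ↭-trans; prep; swap; ↭-reflexive; ↭⇒↭ₛ)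
open import Data.List.Relation.Binary.Permutation.Propositional.Properties
  using (shift; ∈-resp-↭; All-resp-↭; filter-↭; map⁺; drop-∷; ++⁺ˡ; ↭-length)
open import Data.List.Relation.Binary.Pointwise using (Pointwise-≡⇒≡)
open import Data.List.Relation.Unary.All as All using (All; []; _∷_)
import Data.List.Relation.Unary.All.Properties as All
open import Data.List.Relation.Unary.AllPairs using (AllPairs; []; _∷_)
open import Data.List.Relation.Unary.Any using (here; there)
open import Data.List.Relation.Unary.Linked using (Linked)
open import Data.List.Relation.Unary.Linked.Properties using (Linked⇒AllPairs)
import Data.List.Relation.Unary.Sorted.TotalOrder.Properties as Sorted
open import Data.List.Relation.Unary.Unique.Propositional using (Unique)
import Data.List.Relation.Unary.Unique.Propositional.Properties as Unique
import Data.List.Sort as Sort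
open import Data.Nat.Base
open import Data.Nat.Divisibility using (_∣_; _∣?_; _∣0; ∣-refl; ∣m∣n⇒∣m+n; ∣m+n∣m⇒∣n; n∣m*n)
open import Data.Nat.ListAction using (sum)
open import Data.Nat.ListAction.Properties using (sum-++; sum-↭)
open import Data.Nat.Properties
open import Data.Nat.Solver using (module +-*-Solver)
open import Data.Product.Base using (_×_; _,_; ∃; ∃₂; proj₁; proj₂; map₁)
open import Data.Sum.Base using (_⊎_; inj₁; inj₂)
open import Function.Base using (_∘_; flip)
open import Level using (0ℓ)
import Relation.Binary.Construct.Flip.EqAndOrd as Flip
open import Relation.Binary.Definitions using (tri<; tri≈; tri>)
open import Relation.Binary.PropositionalEquality
  using (_≡_; _≢_; refl; sym; trans; cong; cong₂; subst; subst₂; module ≡-Reasoning)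
open import Relation.Nullary using (¬_; yes; no; contradiction; from-no)
open import Relation.Unary using (Pred; Decidable; _≐_)

-- Counting list entries by a decidable predicate.

private variable
  X Y : Set
  P Q : Pred X 0ℓ

count : {P : Pred X 0ℓ} → Decidable P → List X → ℕ
count P? xs = length (filter P? xs)

count-++ : (P? : Decidable P) → ∀ xs ys → count P? (xs ++ ys) ≡ count P? xs + count P? ys
count-++ P? xs ys = trans (cong length (filter-++ P? xs ys)) (length-++ (filter P? xs))

count-map : (P? : Decidable P) (f : X → Y) → ∀ xs → count P? (map f xs) ≡ count (P? ∘ f) xs
count-map P? f []       = refl
count-map P? f (x ∷ xs) with P? (f x)
... | yes _ = cong suc (count-map P? f xs)
... | no  _ = count-map P? f xs

count-≐ : (P? : Decidable P) (Q? : Decidable Q) → P ≐ Q → ∀ xs → count P? xs ≡ count Q? xs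
count-≐ P? Q? P≐Q xs = cong length (filter-≐ P? Q? P≐Q xs)

count-none : (P? : Decidable P) → ∀ {xs} → All (λ x → ¬ P x) xs → count P? xs ≡ 0
count-none P? none = cong length (filter-none P? none)

count-yes : (P? : Decidable P) → ∀ {x} → P x → count P? [ x ] ≡ 1
count-yes P? px = cong length (filter-accept P? px)

count-no : (P? : Decidable P) → ∀ {x} → ¬ P x → count P? [ x ] ≡ 0
count-no P? ¬px = cong length (filter-reject P? ¬px)

count-singleton : (P? : Decidable P) (Q? : Decidable Q) → ∀ {x y} → (P x → Q y) → (Q y → P x) →
                  count P? [ x ] ≡ count Q? [ y ]
count-singleton P? Q? {y = y} f g with Q? y
... | yes q = count-yes P? (g q)
... | no ¬q = count-no P? (¬q ∘ f)

count-upTo-suc : {P : Pred ℕ 0ℓ} (P? : Decidable P) → ∀ n →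
  count P? (upTo (suc n)) ≡ count P? (upTo n) + count P? [ n ]
count-upTo-suc P? n = trans (cong (count P?) (sym (upTo-∷ʳ n))) (count-++ P? (upTo n) [ n ])

count-upTo-> : ∀ j n → count (j <?_) (upTo n) ≡ n ∸ suc j
count-upTo-> j zero    = refl
count-upTo-> j (suc n) = trans (count-upTo-suc (j <?_) n)
  (trans (cong (_+ count (j <?_) [ n ]) (count-upTo-> j n)) last)
  where
  last : n ∸ suc j + count (j <?_) [ n ] ≡ n ∸ j
  last with j <? n
  ... | yes j<n = trans (cong (n ∸ suc j +_) (count-yes (j <?_) j<n))
    (trans (+-comm _ 1) (sym (+-∸-assoc 1 j<n)))
  ... | no  j≮n = trans (cong (n ∸ suc j +_) (count-no (j <?_) j≮n)) (trans (+-identityʳ _)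
    (trans (m≤n⇒m∸n≡0 (m≤n⇒m≤1+n (≮⇒≥ j≮n))) (sym (m≤n⇒m∸n≡0 (≮⇒≥ j≮n)))))

-- The right side is 0 or 1, written as a count over `[ n ]` because this is the contribution of the
-- head to `columnLength j (n ∷ ps)`.
count-upTo-≡ : ∀ j n → count (_≟ j) (upTo n) ≡ count (j <?_) [ n ]
count-upTo-≡ j zero    = refl
count-upTo-≡ j (suc n) = trans (count-upTo-suc (_≟ j) n)
  (trans (cong (_+ count (_≟ j) [ n ]) (count-upTo-≡ j n)) last)
  where
  last : count (j <?_) [ n ] + count (_≟ j) [ n ] ≡ count (j <?_) [ suc n ]
  last with <-cmp j n
  ... | tri< j<n j≢n _ = trans (cong₂ _+_ (count-yes (j <?_) j<n) (count-no (_≟ j) (j≢n ∘ sym)))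
                               (sym (count-yes (j <?_) (m<n⇒m<1+n j<n)))
  ... | tri≈ j≮n j≡n _ = trans (cong₂ _+_ (count-no (j <?_) j≮n) (count-yes (_≟ j) (sym j≡n)))
                               (sym (count-yes (j <?_) (s≤s (≤-reflexive j≡n))))
  ... | tri> j≮n j≢n n<j = trans (cong₂ _+_ (count-no (j <?_) j≮n) (count-no (_≟ j) (j≢n ∘ sym)))
                                 (sym (count-no (j <?_) (≤⇒≯ n<j)))

-- Hook lengths, one row at a time.

count-youngDiagram-∷ : {P : Pred Box 0ℓ} (P? : Decidable P) → ∀ p ps →
  count P? (youngDiagram (p ∷ ps)) ≡
  count (λ j → P? (0 , j)) (upTo p) + count (P? ∘ map₁ suc) (youngDiagram ps)
count-youngDiagram-∷ P? p ps = trans (count-++ P? (map (0 ,_) (upTo p)) _)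
  (cong₂ _+_ (count-map P? (0 ,_) (upTo p)) (count-map P? (map₁ suc) (youngDiagram ps)))

-- The parts of the conjugate partition, indexed from 0: column `j` meets the rows whose part
-- exceeds `j`.
columnLength : ℕ → List ℕ → ℕ
columnLength j = count (j <?_)

count-column : ∀ j ps → count (λ b → proj₂ b ≟ j) (youngDiagram ps) ≡ columnLength j ps
count-column j []       = refl
count-column j (p ∷ ps) = trans (count-youngDiagram-∷ (λ b → proj₂ b ≟ j) p ps)
  (trans (cong₂ _+_ (count-upTo-≡ j p) (count-column j ps))
         (sym (count-++ (j <?_) [ p ] ps)))

hookLength-firstRow : ∀ p ps j → hookLength (p ∷ ps) (0 , j) ≡ (p ∸ suc j) + columnLength j ps + 1
hookLength-firstRow p ps j = cong (_+ 1) (cong₂ _+_ arm leg)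
  where
  arm : count (rightOf? (0 , j)) (youngDiagram (p ∷ ps)) ≡ p ∸ suc j
  arm = trans (count-youngDiagram-∷ (rightOf? (0 , j)) p ps)
    (trans (cong₂ _+_
      (trans (count-≐ _ (j <?_) (proj₂ , (refl ,_)) (upTo p)) (count-upTo-> j p))
      (count-none (rightOf? (0 , j) ∘ map₁ suc) (All.universal (λ _ ()) (youngDiagram ps))))
      (+-identityʳ _))
  leg : count (below? (0 , j)) (youngDiagram (p ∷ ps)) ≡ columnLength j ps
  leg = trans (count-youngDiagram-∷ (below? (0 , j)) p ps)
    (cong₂ _+_
      (count-none (λ i → below? (0 , j) (0 , i)) (All.universal (λ _ ()) (upTo p)))
      (trans (count-≐ _ (λ b → proj₂ b ≟ j) (proj₂ , (z<s ,_)) (youngDiagram ps))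
             (count-column j ps)))

-- Hooks extend only to the right and down, so a row added on top leaves those of the other rows
-- unchanged.
hookLength-laterRow : ∀ p ps b → hookLength (p ∷ ps) (map₁ suc b) ≡ hookLength ps b
hookLength-laterRow p ps b = cong (_+ 1) (cong₂ _+_ arm leg)
  where
  arm : count (rightOf? (map₁ suc b)) (youngDiagram (p ∷ ps)) ≡ count (rightOf? b) (youngDiagram ps)
  arm = trans (count-youngDiagram-∷ (rightOf? (map₁ suc b)) p ps)
    (cong₂ _+_
      (count-none (λ j → rightOf? (map₁ suc b) (0 , j)) (All.universal (λ _ ()) (upTo p)))
      (count-≐ _ _ (map₁ suc-injective , map₁ (cong suc)) (youngDiagram ps)))
  leg : count (below? (map₁ suc b)) (youngDiagram (p ∷ ps)) ≡ count (below? b) (youngDiagram ps)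
  leg = trans (count-youngDiagram-∷ (below? (map₁ suc b)) p ps)
    (cong₂ _+_
      (count-none (λ j → below? (map₁ suc b) (0 , j)) (All.universal (λ _ ()) (upTo p)))
      (count-≐ _ _ (map₁ s<s⁻¹ , map₁ s<s) (youngDiagram ps)))

hooksOfLength-∷ : ∀ k p ps → hooksOfLength k (p ∷ ps) ≡
  count (λ j → (p ∸ suc j) + columnLength j ps + 1 ≟ k) (upTo p) + hooksOfLength k ps
hooksOfLength-∷ k p ps = trans (count-youngDiagram-∷ _ p ps)
  (cong₂ _+_
    (count-≐ _ _
      ( (λ {j} → trans (sym (hookLength-firstRow p ps j)))
      , (λ {j} → trans (hookLength-firstRow p ps j))) (upTo p))
    (count-≐ _ _
      ( (λ {c} → trans (sym (hookLength-laterRow p ps c)))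
      , (λ {c} → trans (hookLength-laterRow p ps c))) (youngDiagram ps)))

-- Markers of the hooks of length 2.

-- A hook of length 2 lies either in the last two boxes of a row whose part p
-- occurs while p - 1 does not (single p), or in the last column of the last two
-- of several rows with the same part p (double p).
data Marker : Set where
  single double : ℕ → Marker

-- The first argument is the column of the last box, one less than the part. The box before the last
-- has arm 1, so its hook has length 2 exactly when its leg is 0; in `legMarkers` the last box has
-- arm 0 and needs leg 1.
armMarkers : ℕ → List ℕ → List Marker
armMarkers zero    ps = []
armMarkers (suc p) ps = filter (λ _ → columnLength p ps ≟ 0) [ single (2 + p) ]

legMarkers : ℕ → List ℕ → List Marker
legMarkers p ps = filter (λ _ → columnLength p ps ≟ 1) [ double (suc p) ]

rowMarkers : ℕ → List ℕ → List Marker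
rowMarkers zero    ps = []
rowMarkers (suc p) ps = armMarkers p ps ++ legMarkers p ps

markers : List ℕ → List Marker
markers []       = []
markers (p ∷ ps) = rowMarkers p ps ++ markers ps

length-rowMarkers : ∀ p ps →
  count (λ j → (p ∸ suc j) + columnLength j ps + 1 ≟ 2) (upTo p) ≡ length (rowMarkers p ps)
length-rowMarkers zero ps = refl
length-rowMarkers (suc p) ps = trans (count-upTo-suc (hook? p) p)
  (trans (cong₂ _+_ (arms p) legs) (sym (length-++ (armMarkers p ps))))
  where
  hook : ℕ → ℕ → ℕ
  hook p j = (suc p ∸ suc j) + columnLength j ps + 1
  hook-diag : ∀ p → hook p p ≡ suc (columnLength p ps)
  hook-diag p = trans (+-comm _ 1) (cong (λ d → suc (d + columnLength p ps)) (n∸n≡0 p))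
  hook? : ∀ p → Decidable (λ j → hook p j ≡ 2)
  hook? p j = hook p j ≟ 2
  legs : count (hook? p) [ p ] ≡ length (legMarkers p ps)
  legs = count-singleton (hook? p) (λ _ → columnLength p ps ≟ 1)
    (λ eq → suc-injective (trans (sym (hook-diag p)) eq))
    (λ eq → trans (hook-diag p) (cong suc eq))
  hook-off : ∀ p → hook (suc p) p ≡ 2 + columnLength p ps
  hook-off p = trans (+-comm _ 1) (cong (λ d → suc (d + columnLength p ps)) (m+n∸n≡m 1 p))
  arms : ∀ p → count (hook? p) (upTo p) ≡ length (armMarkers p ps)
  arms zero    = refl
  arms (suc p) = trans (count-upTo-suc (hook? (suc p)) p) (cong₂ _+_
    (count-none (hook? (suc p)) (All.map long (All.all-upTo p)))
    (count-singleton (hook? (suc p)) (λ _ → columnLength p ps ≟ 0)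
      (λ eq → suc-injective (suc-injective (trans (sym (hook-off p)) eq)))
      (λ eq → trans (hook-off p) (cong (2 +_) eq))))
    where
    -- Boxes before the last two of the row have arm at least 2, so their hooks are too long.
    long : ∀ {j} → j < p → ¬ (hook (suc p) j ≡ 2)
    long {j} j<p eq = <-irrefl (sym eq) (begin-strict
      2                          ≤⟨ s≤s (m<n⇒0<n∸m j<p) ⟩
      suc (p ∸ j)                ≡⟨ +-∸-assoc 1 (<⇒≤ j<p) ⟨
      suc p ∸ j                  ≤⟨ m≤m+n _ _ ⟩
      suc p ∸ j + columnLength j ps  <⟨ m<m+n _ z<s ⟩
      hook (suc p) j             ∎)
      where open ≤-Reasoning

length-markers : ∀ ps → hooksOfLength 2 ps ≡ length (markers ps)
length-markers []       = refl
length-markers (p ∷ ps) = trans (hooksOfLength-∷ 2 p ps)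
  (trans (cong₂ _+_ (length-rowMarkers p ps) (length-markers ps))
         (sym (length-++ (rowMarkers p ps))))

-- Markers in terms of the parts of the partition.

parts : Marker → List ℕ
parts (single p) = p ∷ []
parts (double p) = p ∷ p ∷ []

∈⇒↭ : ∀ {x : ℕ} {xs} → x ∈ xs → ∃ λ ys → xs ↭ x ∷ ys
∈⇒↭ {x} x∈xs with ys , zs , refl ← ∈-∃++ x∈xs = ys ++ zs , shift x ys zs

count>0⇒∃ : {P : Pred X 0ℓ} (P? : Decidable P) → ∀ {xs} → 0 < count P? xs → ∃ λ x → x ∈ xs × P x
count>0⇒∃ P? {xs} pos with filter P? xs in eq
... | x ∷ _ = x , ∈-filter⁻ P? (subst (x ∈_) (sym eq) (here refl))

columnLength≡0⇒≤ : ∀ {p q ps} → columnLength p ps ≡ 0 → q ∈ ps → q ≤ p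
columnLength≡0⇒≤ {p} eq q∈ps = ≮⇒≥ λ p<q → <⇒≢ (filter-some (p <?_) (lose q∈ps p<q)) (sym eq)

-- This keeps `double (suc p)` from being marked at two rows: with two copies of `suc p` still
-- below, the leg is at least 2.
columnLength-twice : ∀ {p ps μ} → ps ↭ parts (double (suc p)) ++ μ → columnLength p ps ≢ 1
columnLength-twice {p} {ps} {μ} ps↭ eq = contradiction (trans (sym twice) eq) λ ()
  where
  twice : columnLength p ps ≡ 2 + columnLength p μ
  twice = trans (↭-length (filter-↭ (p <?_) ps↭))
    (trans (count-++ (p <?_) [ suc p ] (suc p ∷ μ))
      (cong₂ _+_ one (trans (count-++ (p <?_) [ suc p ] μ) (cong (_+ columnLength p μ) one))))
    where
    one = count-yes (p <?_) (n<1+n p)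

marker⇒parts : ∀ {ps m} → AllPairs _≥_ ps → m ∈ markers ps → ∃ λ μ → ps ↭ parts m ++ μ
rowMarker⇒parts : ∀ {p ps m} → All (p ≥_) ps → m ∈ rowMarkers p ps →
                  ∃ λ μ → p ∷ ps ↭ parts m ++ μ

marker⇒parts {p ∷ ps} {m} (p≥ps ∷ sorted) m∈ with ∈-++⁻ (rowMarkers p ps) m∈
... | inj₁ m∈row  = rowMarker⇒parts p≥ps m∈row
... | inj₂ m∈rest with μ , ps↭ ← marker⇒parts sorted m∈rest =
  p ∷ μ , ↭-trans (prep p ps↭) (↭-sym (shift p (parts m) μ))

rowMarker⇒parts {suc p} {ps} p≥ps m∈row with ∈-++⁻ (armMarkers p ps) m∈row
rowMarker⇒parts {suc (suc p)} {ps} p≥ps m∈row | inj₁ m∈arm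
  with ∈-filter⁻ (λ _ → columnLength p ps ≟ 0) {xs = [ single (2 + p) ]} m∈arm
... | here refl , _ = ps , ↭-refl
rowMarker⇒parts {suc p} {ps} p≥ps m∈row | inj₂ m∈leg
  with ∈-filter⁻ (λ _ → columnLength p ps ≟ 1) {xs = [ double (suc p) ]} m∈leg
... | here refl , eq
  -- The one lower part exceeding `p` is at most `suc p` by sortedness, so it is a second copy of
  -- `suc p`.
  with q , q∈ps , p<q ← count>0⇒∃ (p <?_) {ps} (≤-reflexive (sym eq))
  with refl ← ≤-antisym p<q (All.lookup p≥ps q∈ps)
  with μ , ps↭ ← ∈⇒↭ q∈ps = μ , prep (suc p) ps↭

single∈⇒>1 : ∀ {ps p} → single p ∈ markers ps → 1 < p
single∈⇒>1 {zero ∷ ps} m∈ = single∈⇒>1 {ps} m∈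
single∈⇒>1 {suc q ∷ ps} m∈ with ∈-++⁻ (rowMarkers (suc q) ps) m∈
... | inj₂ m∈rest = single∈⇒>1 {ps} m∈rest
... | inj₁ m∈row with ∈-++⁻ (armMarkers q ps) m∈row
...   | inj₂ m∈leg with ∈-filter⁻ (λ _ → columnLength q ps ≟ 1) {xs = [ double (suc q) ]} m∈leg
...     | here () , _
single∈⇒>1 {suc (suc q) ∷ ps} m∈ | inj₁ m∈row | inj₁ m∈arm
  with ∈-filter⁻ (λ _ → columnLength q ps ≟ 0) {xs = [ single (2 + q) ]} m∈arm
... | here refl , _ = s≤s z<s

rowMarkers-unique : ∀ p ps → Unique (rowMarkers p ps)
rowMarkers-unique zero ps = []
rowMarkers-unique (suc p) ps =
  Unique.++⁺ (arm p) (Unique.filter⁺ (λ _ → columnLength p ps ≟ 1) ([] ∷ [])) (disjoint p)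
  where
  arm : ∀ p → Unique (armMarkers p ps)
  arm zero    = []
  arm (suc p) = Unique.filter⁺ (λ _ → columnLength p ps ≟ 0) ([] ∷ [])
  disjoint : ∀ p {m} → ¬ (m ∈ armMarkers p ps × m ∈ legMarkers p ps)
  disjoint (suc p) (m∈arm , m∈leg)
    with ∈-filter⁻ (λ _ → columnLength p ps ≟ 0) {xs = [ single (2 + p) ]} m∈arm
       | ∈-filter⁻ (λ _ → columnLength (suc p) ps ≟ 1) {xs = [ double (2 + p) ]} m∈leg
  ... | here refl , _ | here () , _

markers-unique : ∀ {ps} → AllPairs _≥_ ps → Unique (markers ps)
markers-unique [] = []
markers-unique {p ∷ ps} (_ ∷ sorted) =
  Unique.++⁺ (rowMarkers-unique p ps) (markers-unique sorted) (disjoint p)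
  where
  disjoint : ∀ p {m} → ¬ (m ∈ rowMarkers p ps × m ∈ markers ps)
  disjoint (suc p) (m∈row , m∈rest) with ∈-++⁻ (armMarkers p ps) m∈row | marker⇒parts sorted m∈rest
  disjoint (suc p) (m∈row , m∈rest) | inj₂ m∈leg | _ , ps↭
    with ∈-filter⁻ (λ _ → columnLength p ps ≟ 1) {xs = [ double (suc p) ]} m∈leg
  ... | here refl , eq = columnLength-twice ps↭ eq
  disjoint (suc (suc p)) (m∈row , m∈rest) | inj₁ m∈arm | _ , ps↭
    with ∈-filter⁻ (λ _ → columnLength p ps ≟ 0) {xs = [ single (2 + p) ]} m∈arm
  ... | here refl , eq =
    1+n≰n (≤-trans (n≤1+n _) (columnLength≡0⇒≤ eq (∈-resp-↭ (↭-sym ps↭) (here refl))))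

-- The marker arises at the last copy of `2 + p`: all lower parts are then at most `p`, which makes
-- the leg 0.
single∈markers : ∀ {p ps} → AllPairs _≥_ ps → 2 + p ∈ ps → 1 + p ∉ ps →
                 single (2 + p) ∈ markers ps
single∈markers {p} {q ∷ ps} (q≥ps ∷ sorted) 2+p∈ 1+p∉ with member? _≟_ (2 + p) ps | 2+p∈
... | yes 2+p∈ps | _ = ∈-++⁺ʳ (rowMarkers q ps) (single∈markers sorted 2+p∈ps (1+p∉ ∘ there))
... | no 2+p∉ps | there 2+p∈ps = contradiction 2+p∈ps 2+p∉ps
... | no 2+p∉ps | here refl =
  ∈-++⁺ˡ {xs = rowMarkers (2 + p) ps} (∈-++⁺ˡ {xs = armMarkers (suc p) ps}
    (∈-filter⁺ (λ _ → columnLength p ps ≟ 0) (here refl) (count-none (p <?_) (All.tabulate small))))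
  where
  small : ∀ {q} → q ∈ ps → ¬ (p < q)
  small q∈ps p<q with m≤n⇒m<n∨m≡n (All.lookup q≥ps q∈ps)
  ... | inj₂ refl = 2+p∉ps q∈ps
  ... | inj₁ q<2+p with refl ← ≤-antisym p<q (s≤s⁻¹ q<2+p) = 1+p∉ (there q∈ps)

-- Two positions holding `p`: a form of `ps ↭ p ∷ p ∷ μ` that can be followed down a list by
-- induction.
data Twice (p : ℕ) : List ℕ → Set where
  here  : ∀ {ps} → p ∈ ps → Twice p (p ∷ ps)
  there : ∀ {q ps} → Twice p ps → Twice p (q ∷ ps)

Twice-resp-↭ : ∀ {p ps qs} → ps ↭ qs → Twice p ps → Twice p qs
Twice-resp-↭ Perm.refl t = t
Twice-resp-↭ (prep _ eq) (here p∈) = here (∈-resp-↭ eq p∈)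
Twice-resp-↭ (prep _ eq) (there t) = there (Twice-resp-↭ eq t)
Twice-resp-↭ (swap _ _ eq) (here (here refl)) = here (here refl)
Twice-resp-↭ (swap _ _ eq) (here (there p∈)) = there (here (∈-resp-↭ eq p∈))
Twice-resp-↭ (swap _ _ eq) (there (here p∈)) = here (there (∈-resp-↭ eq p∈))
Twice-resp-↭ (swap _ _ eq) (there (there t)) = there (there (Twice-resp-↭ eq t))
Twice-resp-↭ (Perm.trans eq₁ eq₂) t = Twice-resp-↭ eq₂ (Twice-resp-↭ eq₁ t)

-- In a sorted list the copies of `suc p` are consecutive, and the marker arises at the last but
-- one; the recursion skips the earlier copies.
twice⇒double∈markers : ∀ {p ps} → AllPairs _≥_ ps → Twice (suc p) ps → double (suc p) ∈ markers ps
twice⇒double∈markers {ps = q ∷ ps} (_ ∷ sorted) (there t) =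
  ∈-++⁺ʳ (rowMarkers q ps) (twice⇒double∈markers sorted t)
twice⇒double∈markers {p} {r ∷ q ∷ ps} ((p≥q ∷ _) ∷ sorted@(q≥ps ∷ _)) (here p∈) =
  step p≥q q≥ps p∈ (twice⇒double∈markers sorted)
  where
  step : suc p ≥ q → All (q ≥_) ps → suc p ∈ q ∷ ps →
         (Twice (suc p) (q ∷ ps) → double (suc p) ∈ markers (q ∷ ps)) →
         double (suc p) ∈ markers (suc p ∷ q ∷ ps)
  step p≥q q≥ps p∈ recurse
    with ≤-antisym p≥q (All.lookup (≤-refl ∷ q≥ps) p∈) | member? _≟_ (suc p) ps
  ... | refl | yes p∈ps = ∈-++⁺ʳ (rowMarkers (suc p) (suc p ∷ ps)) (recurse (here p∈ps))
  ... | refl | no p∉ps =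
    ∈-++⁺ˡ {xs = rowMarkers (suc p) (suc p ∷ ps)} (∈-++⁺ʳ (armMarkers p (suc p ∷ ps))
      (∈-filter⁺ (λ _ → columnLength p (suc p ∷ ps) ≟ 1) (here refl) once))
    where
    small : ∀ {q} → q ∈ ps → ¬ (p < q)
    small q∈ps p<q with refl ← ≤-antisym p<q (All.lookup q≥ps q∈ps) = p∉ps q∈ps
    once : columnLength p (suc p ∷ ps) ≡ 1
    once = trans (count-++ (p <?_) [ suc p ] ps)
      (cong₂ _+_ (count-yes (p <?_) (n<1+n p)) (count-none (p <?_) (All.tabulate small)))

double∈markers : ∀ {p ps μ} → AllPairs _≥_ ps → ps ↭ parts (double (suc p)) ++ μ →
                 double (suc p) ∈ markers ps
double∈markers sorted ps↭ =
  twice⇒double∈markers sorted (Twice-resp-↭ (↭-sym ps↭) (here (here refl)))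

-- Matching the offsets.

-- A, B and C index the three families of offsets in the lower bound for b 3 2 n.
data Code : Set where
  A B C : ℕ → Code

size : Code → ℕ
size (A i) = 2 + i * 3
size (B i) = 4 + i * 3
size (C i) = 4 + i * 6

weight : Marker → ℕ
weight m = sum (parts m)

-- The period 12 is the least common multiple of the steps 2 and 4 of the weights of odd markers and
-- the steps 3 and 6 of the sizes of codes.
shift₁₂ : Marker → Marker
shift₁₂ (single p) = single (12 + p)
shift₁₂ (double p) = double (6 + p)

-- The matching of offsets is 12-periodic, except that single 3 goes to B 0: the values at
-- B 4, B 8, ... are junk, no offset being matched with these codes.
source : Code → Marker
source (A 0) = double 1
source (A 1) = double 3
source (A 2) = single 9
source (A 3) = single 15
source (A (suc (suc (suc (suc i))))) = shift₁₂ (source (A i))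
source (B 0) = single 3
source (B 1) = single 7
source (B 2) = double 5
source (B 3) = single 13
source (B (suc (suc (suc (suc i))))) = shift₁₂ (source (B i))
source (C i) = single (5 + i * 6)

next : Code → Code
next (A i) = A (4 + i)
next (B i) = B (4 + i)
next (C i) = C (2 + i)

source-next : ∀ c → source (next c) ≡ shift₁₂ (source c)
source-next (A i) = refl
source-next (B i) = refl
source-next (C i) = refl

size-next : ∀ c → size (next c) ≡ 12 + size c
size-next (A i) = refl
size-next (B i) = refl
size-next (C i) = refl

weight-shift₁₂ : ∀ m → weight (shift₁₂ m) ≡ 12 + weight m
weight-shift₁₂ (single p) = refl
weight-shift₁₂ (double p) =
  solve 1 (λ p → con 6 :+ p :+ (con 6 :+ p :+ con 0) := con 12 :+ (p :+ (p :+ con 0))) refl p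
  where open +-*-Solver

-- As `source` goes from codes to markers, distinct markers have distinct codes by construction.
SmallCode : Marker → Set
SmallCode m = ∃ λ c → source c ≡ m × size c ≤ weight m

smallCode-shift₁₂ : ∀ {m} → SmallCode m → SmallCode (shift₁₂ m)
smallCode-shift₁₂ {m} (c , eq , le) = next c , trans (source-next c) (cong shift₁₂ eq) ,
  subst₂ _≤_ (sym (size-next c)) (sym (weight-shift₁₂ m)) (+-monoʳ-≤ 12 le)

smallCode-single : ∀ k → SmallCode (single (3 + k * 2)) ⊎ k ≡ 0
smallCode-single 0 = inj₂ refl
smallCode-single 1 = inj₁ (C 0 , refl , m≤n+m 4 1)
smallCode-single 2 = inj₁ (B 1 , refl , ≤-refl)
smallCode-single 3 = inj₁ (A 2 , refl , m≤n+m 8 1)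
smallCode-single 4 = inj₁ (C 1 , refl , m≤n+m 10 1)
smallCode-single 5 = inj₁ (B 3 , refl , ≤-refl)
smallCode-single (suc (suc (suc (suc (suc (suc k)))))) with smallCode-single k
... | inj₁ small  = inj₁ (smallCode-shift₁₂ small)
-- `single 15` is the shift of the exceptional `single 3` and inherits no code, so it gets `A 3`, of
-- size 11.
... | inj₂ refl = inj₁ (A 3 , refl , m≤n+m 11 4)

smallCode-double : ∀ k → SmallCode (double (1 + k * 2))
smallCode-double 0 = A 0 , refl , ≤-refl
smallCode-double 1 = A 1 , refl , m≤n+m 5 1
smallCode-double 2 = B 2 , refl , ≤-refl
smallCode-double (suc (suc (suc k))) = smallCode-shift₁₂ (smallCode-double k)

data OddMarker : Marker → Set where
  single : ∀ k → OddMarker (single (3 + k * 2))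
  double : ∀ k → OddMarker (double (1 + k * 2))

-- The excess of 1 over the weight is what `sum-nonTriple` can absorb. It occurs only for
-- `single 3`, where the bound by `n` is the hypothesis `n > 3`.
smallCode-exists : ∀ {n m} → n > 3 → OddMarker m → weight m ≤ n →
              ∃ λ c → source c ≡ m × size c ≤ suc (weight m) × size c ≤ n
smallCode-exists n>3 (single k) w≤n with smallCode-single k
... | inj₁ (c , eq , le) = c , eq , m≤n⇒m≤1+n le , ≤-trans le w≤n
... | inj₂ refl        = B 0 , refl , ≤-refl , n>3
smallCode-exists n>3 (double k) w≤n with c , eq , le ← smallCode-double k =
  c , eq , m≤n⇒m≤1+n le , ≤-trans le w≤n

-- Creating a hook with a given code in a 3-regular partition.

successor : Code → Code
successor (A i) = A (suc i)
successor (B i) = B (suc i)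
successor (C i) = C (suc i)

-- The values at single 0, single 1, single (3 + 3 i) and double (3 i) are junk.
code : Marker → Code
code (single 0) = A 0
code (single 1) = A 0
code (single 2) = A 0
code (single 4) = B 0
code (single (suc (suc (suc p)))) = successor (code (single p))
code (double 0) = A 0
code (double 1) = A 0
code (double 2) = C 0
code (double (suc (suc (suc p)))) = successor (code (double p))

code-armA : ∀ i → code (single (2 + i * 3)) ≡ A i
code-armA zero    = refl
code-armA (suc i) = cong successor (code-armA i)

code-armB : ∀ i → code (single (4 + i * 3)) ≡ B i
code-armB zero    = refl
code-armB (suc i) = cong successor (code-armB i)

code-legA : ∀ i → code (double (1 + i * 3)) ≡ A i
code-legA zero    = refl
code-legA (suc i) = cong successor (code-legA i)

code-legC : ∀ i → code (double (2 + i * 3)) ≡ C i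
code-legC zero    = refl
code-legC (suc i) = cong successor (code-legC i)

-- For p ≡ 1 mod 3 the pair p, p arises from p + 1, p, so 1 and p are what replaces p + 1.
insertedLeg : Code → ℕ → List ℕ
insertedLeg (C _) p = p ∷ p ∷ []
insertedLeg _     p = 1 ∷ p ∷ []

inserted : Marker → List ℕ
inserted (single p) = [ p ]
inserted (double p) = insertedLeg (code (double p)) p

3∤r+i*3 : ∀ {r} i → ¬ 3 ∣ r → ¬ 3 ∣ r + i * 3
3∤r+i*3 i 3∤r 3∣ = 3∤r (∣m+n∣m⇒∣n (subst (3 ∣_) (+-comm _ (i * 3)) 3∣) (n∣m*n i))

3∤1+i*3 : ∀ i → ¬ 3 ∣ 1 + i * 3
3∤1+i*3 i = 3∤r+i*3 {1} i (from-no (3 ∣? 1))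

3∤2+i*3 : ∀ i → ¬ 3 ∣ 2 + i * 3
3∤2+i*3 i = 3∤r+i*3 {2} i (from-no (3 ∣? 2))

-- The parts `inserted marker` are added to `ν`. The marker alone determines both the code and the
-- inserted parts, so the step can be undone.
record Placement (c : Code) (ν : List ℕ) : Set where
  field
    marker   : Marker
    code≡    : code marker ≡ c
    sum≡     : sum (inserted marker) ≡ size c
    regular  : IsRegular 3 (inserted marker)
    ∈markers : ∀ {ps} → AllPairs _≥_ ps → IsRegular 3 ps → ps ↭ inserted marker ++ ν →
               marker ∈ markers ps

-- For `A i`, adding 3i+2 gives a single marker unless 3i+1 is present; in that case 1 and 3i+1,
-- with the same sum, are added and 3i+1 occurs twice. For `B i`, the part 3i+3 that could spoil the
-- marker is excluded by regularity. For `C i`, two copies of 3i+2 are added.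
place : ∀ c ν → Placement c ν
place (A i) ν with member? _≟_ (1 + i * 3) ν
... | no ∉ν = record
  { marker   = single (2 + i * 3)
  ; code≡    = code-armA i
  ; sum≡     = +-identityʳ _
  ; regular  = 3∤2+i*3 i ∷ []
  ; ∈markers = λ sorted _ ps↭ → single∈markers sorted (∈-resp-↭ (↭-sym ps↭) (here refl))
      λ ∈ps → case∉ (∈-resp-↭ ps↭ ∈ps)
  }
  where
  case∉ : 1 + i * 3 ∉ 2 + i * 3 ∷ ν
  case∉ (here eq) = 1+n≢n (sym eq)
  case∉ (there ∈ν) = ∉ν ∈ν
... | yes ∈ν = record
  { marker   = double (1 + i * 3)
  ; code≡    = code-legA i
  ; sum≡     = trans (cong sum ins≡) (cong (2 +_) (+-identityʳ _))
  ; regular  = subst (IsRegular 3) (sym ins≡) (from-no (3 ∣? 1) ∷ 3∤1+i*3 i ∷ [])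
  ; ∈markers = λ sorted _ ps↭ → double∈markers sorted (↭-trans ps↭ (twice (∈⇒↭ ∈ν)))
  }
  where
  p = 1 + i * 3
  ins≡ : inserted (double p) ≡ 1 ∷ p ∷ []
  ins≡ = cong (λ c → insertedLeg c p) (code-legA i)
  twice : (r : ∃ λ ν′ → ν ↭ p ∷ ν′) → inserted (double p) ++ ν ↭ p ∷ p ∷ 1 ∷ proj₁ r
  twice (ν′ , ν↭) = ↭-trans (↭-reflexive (cong (_++ ν) ins≡))
    (↭-trans (prep 1 (prep p ν↭)) (↭-sym (shift 1 (p ∷ p ∷ []) ν′)))
place (B i) ν = record
  { marker   = single (4 + i * 3)
  ; code≡    = code-armB i
  ; sum≡     = +-identityʳ _
  ; regular  = 3∤1+i*3 (suc i) ∷ []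
  ; ∈markers = λ sorted reg ps↭ → single∈markers sorted (∈-resp-↭ (↭-sym ps↭) (here refl))
      λ ∈ps → All.lookup reg ∈ps (n∣m*n (suc i))
  }
place (C i) ν = record
  { marker   = double (2 + i * 3)
  ; code≡    = code-legC i
  ; sum≡     = trans (cong sum ins≡)
      (solve 1 (λ i → con 2 :+ i :* con 3 :+ (con 2 :+ i :* con 3 :+ con 0)
                   := con 4 :+ i :* con 6) refl i)
  ; regular  = subst (IsRegular 3) (sym ins≡) (3∤2+i*3 i ∷ 3∤2+i*3 i ∷ [])
  ; ∈markers = λ sorted _ ps↭ →
      double∈markers sorted (↭-trans ps↭ (↭-reflexive (cong (_++ ν) ins≡)))
  }
  where
  open +-*-Solver
  ins≡ : inserted (double (2 + i * 3)) ≡ 2 + i * 3 ∷ 2 + i * 3 ∷ []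
  ins≡ = cong (λ c → insertedLeg c (2 + i * 3)) (code-legC i)

-- From odd parts to parts not divisible by 3.

odd : ℕ → ℕ
odd k = 3 + k * 2

-- The sequence 0, 2, 3, 5, 6, ...; adding 2 gives 2, 4, 5, 7, 8, ..., the non-multiples of 3 above
-- 1.
shrink : ℕ → ℕ
shrink 0             = 0
shrink 1             = 2
shrink (suc (suc k)) = 3 + shrink k

-- The values at 1, 4, 7, ..., which `shrink` omits, are junk.
unshrink : ℕ → ℕ
unshrink 0                   = 0
unshrink 1                   = 0
unshrink 2                   = 1
unshrink (suc (suc (suc r))) = 2 + unshrink r

unshrink-shrink : ∀ k → unshrink (shrink k) ≡ k
unshrink-shrink 0             = refl
unshrink-shrink 1             = refl
unshrink-shrink (suc (suc k)) = cong (2 +_) (unshrink-shrink k)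

shrink≤ : ∀ k → shrink k ≤ k * 2
shrink≤ 0             = ≤-refl
shrink≤ 1             = ≤-refl
shrink≤ (suc (suc k)) = ≤-trans (+-monoʳ-≤ 3 (shrink≤ k)) (n≤1+n _)

nonTriple : ℕ → ℕ
nonTriple k = 2 + shrink k

3∤nonTriple : ∀ k → ¬ 3 ∣ nonTriple k
3∤nonTriple 0 = from-no (3 ∣? 2)
3∤nonTriple 1 = from-no (3 ∣? 4)
3∤nonTriple (suc (suc k)) 3∣ = 3∤nonTriple k (∣m+n∣m⇒∣n 3∣ ∣-refl)

-- Each replacement lowers a part by at least 1, so a nonempty list leaves a unit to spare; for the
-- empty list, `pred` of 0 is 0.
sum-nonTriple : ∀ ks → sum (map nonTriple ks) ≤ pred (sum (map odd ks))
sum-nonTriple []       = z≤n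
sum-nonTriple (k ∷ ks) = +-mono-≤ (+-monoʳ-≤ 2 (shrink≤ k)) (≤-trans (sum-nonTriple ks) pred[n]≤n)

fill : ℕ → List ℕ → List ℕ
fill j ps = replicate j 1 ++ ps

sum-fill : ∀ j ps → sum (fill j ps) ≡ j + sum ps
sum-fill zero    ps = refl
sum-fill (suc j) ps = cong suc (sum-fill j ps)

odds : ∀ {ps} → IsRegular 2 ps → ∃₂ λ j ks → ps ↭ fill j (map odd ks)

2∤⇒odd : ∀ {p} → ¬ 2 ∣ p → ∃ λ k → p ≡ 1 + k * 2
2∤⇒odd {0} 2∤ = contradiction (2 ∣0) 2∤
2∤⇒odd {1} 2∤ = 0 , refl
2∤⇒odd {suc (suc p)} 2∤ with k , eq ← 2∤⇒odd {p} (2∤ ∘ ∣m∣n⇒∣m+n ∣-refl) = suc k , cong (2 +_) eq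

odds [] = 0 , [] , ↭-refl
odds (2∤p ∷ reg) with 2∤⇒odd 2∤p | odds reg
... | zero  , refl | j , ks , ps↭ = suc j , ks , prep 1 ps↭
... | suc k , refl | j , ks , ps↭ =
  j , k ∷ ks , ↭-trans (prep (odd k) ps↭) (↭-sym (shift (odd k) (replicate j 1) (map odd ks)))

-- Forgets the padding by 1s, whose number is recovered from the sum of the partition.
unfill : List ℕ → List ℕ
unfill ps = map (λ p → unshrink (p ∸ 2)) (filter (1 <?_) ps)

unfill-fill : ∀ j ks → unfill (fill j (map nonTriple ks)) ≡ ks
unfill-fill (suc j) ks       = unfill-fill j ks
unfill-fill zero    []       = refl
unfill-fill zero    (k ∷ ks) = cong₂ _∷_ (unshrink-shrink k) (unfill-fill zero ks)

++-cancelˡ-↭ : ∀ ps {qs rs : List ℕ} → ps ++ qs ↭ ps ++ rs → qs ↭ rs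
++-cancelˡ-↭ []       eq = eq
++-cancelˡ-↭ (p ∷ ps) eq = ++-cancelˡ-↭ ps (drop-∷ eq)

-- Tagged lists, and comparing lengths through an injective relation.

module _ {X Y : Set} (f : X → List Y) where

  tagged : List X → List (X × Y)
  tagged []       = []
  tagged (x ∷ xs) = map (x ,_) (f x) ++ tagged xs

  length-tagged : ∀ {g : X → ℕ} → (∀ x → g x ≡ length (f x)) → ∀ xs →
                  sum (map g xs) ≡ length (tagged xs)
  length-tagged g≡ []       = refl
  length-tagged g≡ (x ∷ xs) = trans
    (cong₂ _+_ (trans (g≡ x) (sym (length-map (x ,_) (f x)))) (length-tagged g≡ xs))
    (sym (length-++ (map (x ,_) (f x))))

  ∈-tagged⁺ : ∀ {x y xs} → x ∈ xs → y ∈ f x → (x , y) ∈ tagged xs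
  ∈-tagged⁺ {x} (here refl) y∈ = ∈-++⁺ˡ (∈-map⁺ (x ,_) y∈)
  ∈-tagged⁺ {xs = x ∷ xs} (there x∈) y∈ = ∈-++⁺ʳ (map (x ,_) (f x)) (∈-tagged⁺ x∈ y∈)

  ∈-tagged⁻ : ∀ {x y xs} → (x , y) ∈ tagged xs → x ∈ xs × y ∈ f x
  ∈-tagged⁻ {xs = x ∷ xs} xy∈ with ∈-++⁻ (map (x ,_) (f x)) xy∈
  ... | inj₂ xy∈rest with x∈ , y∈ ← ∈-tagged⁻ {xs = xs} xy∈rest = there x∈ , y∈
  ... | inj₁ xy∈head with _ , y∈ , refl ← ∈-map⁻ (x ,_) xy∈head = here refl , y∈

  tagged-unique : ∀ {xs} → Unique xs → (∀ {x} → x ∈ xs → Unique (f x)) → Unique (tagged xs)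
  tagged-unique {[]} _ _ = []
  tagged-unique {x ∷ xs} (x∉ ∷ unique) f-unique =
    Unique.++⁺ (Unique.map⁺ (λ { refl → refl }) (f-unique (here refl)))
               (tagged-unique unique (f-unique ∘ there)) disjoint
    where
    disjoint : ∀ {xy} → ¬ (xy ∈ map (x ,_) (f x) × xy ∈ tagged xs)
    disjoint (l , r) with _ , _ , refl ← ∈-map⁻ (x ,_) l =
      All.lookup x∉ (proj₁ (∈-tagged⁻ {xs = xs} r)) refl

-- Remove a partner of the head from `ys`; by injectivity the partners of the other entries remain.
-- A relation lets a partner depend on the choices made in an existence proof.
length-≤-injective : {X Y : Set} (R : X → Y → Set) → (∀ {x x′ y} → R x y → R x′ y → x ≡ x′) →
  ∀ {xs ys} → Unique xs → (∀ {x} → x ∈ xs → ∃ λ y → y ∈ ys × R x y) → length xs ≤ length ys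
length-≤-injective R injective [] total = z≤n
length-≤-injective {Y = Y} R injective {x ∷ xs} {ys} (x∉ ∷ unique) total
  with y , y∈ , Rxy ← total (here refl)
  with ys₁ , ys₂ , refl ← ∈-∃++ y∈ =
  ≤-trans (s≤s (length-≤-injective R injective unique total′))
          (≤-reflexive (sym (↭-length (shift y ys₁ ys₂))))
  where
  total′ : ∀ {x′} → x′ ∈ xs → ∃ λ y′ → y′ ∈ ys₁ ++ ys₂ × R x′ y′
  total′ x′∈ with y′ , y′∈ , Rx′y′ ← total (there x′∈) with ∈-resp-↭ (shift y ys₁ ys₂) y′∈
  ... | here refl = contradiction (injective Rxy Rx′y′) (All.lookup x∉ x′∈)
  ... | there y′∈   = y′ , y′∈ , Rx′y′

-- The matching between marked partitions.

open Sort (Flip.decTotalOrder ≤-decTotalOrder) using (sort; sort-↭; sort-↗)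

sorted-↭⇒≡ : ∀ {ps qs} → Linked _≥_ ps → Linked _≥_ qs → ps ↭ qs → ps ≡ qs
sorted-↭⇒≡ ps↘ qs↘ ps↭qs =
  Pointwise-≡⇒≡ (Sorted.↗↭↗⇒≋ (Flip.totalOrder ≤-totalOrder) ps↘ qs↘ (↭⇒↭ₛ ps↭qs))

Linked⇒Sorted : ∀ {ps} → Linked _≥_ ps → AllPairs _≥_ ps
Linked⇒Sorted = Linked⇒AllPairs (flip ≤-trans)

-- Both partitions are built from the same `ks`, with their own numbers of 1s.
record Match (n : ℕ) (x y : List ℕ × Marker) : Set where
  constructor match
  field
    {ones onesʸ} : ℕ
    {ks}         : List ℕ
    sorted       : Linked _≥_ (proj₁ x)
    sum≡         : sum (proj₁ x) ≡ n
    marker≡      : proj₂ x ≡ source (code (proj₂ y))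
    ↭ˣ           : proj₁ x ↭ parts (proj₂ x) ++ fill ones (map odd ks)
    ↭ʸ           : proj₁ y ↭ inserted (proj₂ y) ++ fill onesʸ (map nonTriple ks)

-- The marker of `y` determines `m`. Cancelling its inserted parts and dropping the 1s gives `ks` up
-- to order, the sum `n` fixes the number of 1s, and sortedness makes the partitions equal.
match-injective : ∀ {n x x′ y} → Match n x y → Match n x′ y → x ≡ x′
match-injective {n} {λ₁ , m} {λ₂ , _} {λ′ , m′}
  (match {j₁} {k₁} {ks₁} s₁ refl refl x₁ y₁) (match {j₂} {k₂} {ks₂} s₂ sum₂ refl x₂ y₂) =
  cong (_, m) (sorted-↭⇒≡ s₁ s₂ (↭-trans x₁ (↭-trans (++⁺ˡ (parts m) same) (↭-sym x₂))))
  where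
  fills : fill k₁ (map nonTriple ks₁) ↭ fill k₂ (map nonTriple ks₂)
  fills = ++-cancelˡ-↭ (inserted m′) (↭-trans (↭-sym y₁) y₂)

  ks↭ : ks₁ ↭ ks₂
  ks↭ = subst₂ _↭_ (unfill-fill k₁ ks₁) (unfill-fill k₂ ks₂) (map⁺ _ (filter-↭ (1 <?_) fills))

  j≡ : j₁ ≡ j₂
  j≡ = +-cancelʳ-≡ (sum (map odd ks₁)) j₁ j₂ (+-cancelˡ-≡ (weight m) _ _ (begin
    weight m + (j₁ + sum (map odd ks₁))  ≡⟨ total j₁ ks₁ x₁ ⟨
    sum λ₁                               ≡⟨ sum₂ ⟨
    sum λ₂                               ≡⟨ total j₂ ks₂ x₂ ⟩
    weight m + (j₂ + sum (map odd ks₂))  ≡⟨ cong (λ s → weight m + (j₂ + s)) (sum-↭ (map⁺ odd ks↭)) ⟨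
    weight m + (j₂ + sum (map odd ks₁))  ∎))
    where
    open ≡-Reasoning
    total : ∀ {ps} j ks → ps ↭ parts m ++ fill j (map odd ks) →
            sum ps ≡ weight m + (j + sum (map odd ks))
    total j ks eq = trans (sum-↭ eq)
      (trans (sum-++ (parts m) _) (cong (weight m +_) (sum-fill j (map odd ks))))

  same : fill j₁ (map odd ks₁) ↭ fill j₂ (map odd ks₂)
  same = ↭-trans (↭-reflexive (cong (λ j → fill j (map odd ks₁)) j≡))
                 (++⁺ˡ (replicate j₂ 1) (map⁺ odd ks↭))

oddMarker : ∀ {ps m μ} → IsRegular 2 ps → m ∈ markers ps → ps ↭ parts m ++ μ → OddMarker m
oddMarker {ps} {single p} reg m∈ ps↭ with 2∤p ∷ _ ← All-resp-↭ ps↭ reg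
  with 2∤⇒odd 2∤p | single∈⇒>1 {ps} m∈
... | zero  , refl | s≤s ()
... | suc k , refl | _ = single k
oddMarker {ps} {double p} reg m∈ ps↭ with 2∤p ∷ _ ← All-resp-↭ ps↭ reg
  with k , refl ← 2∤⇒odd 2∤p = double k

match-exists : ∀ {n ps m} → n > 3 → IsRegularPartition 2 n ps → m ∈ markers ps →
  ∃ λ y → (IsRegularPartition 3 n (proj₁ y) × proj₂ y ∈ markers (proj₁ y)) × Match n (ps , m) y
match-exists {n} {ps} {m} n>3 ((sorted , _ , sum≡n) , regular) m∈
  with μ , ps↭ ← marker⇒parts (Linked⇒Sorted sorted) m∈
  with j , ks , μ↭ ← odds (All.++⁻ʳ (parts m) (All-resp-↭ ps↭ regular)) = result
  where
  ps↭′ : ps ↭ parts m ++ fill j (map odd ks)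
  ps↭′ = ↭-trans ps↭ (++⁺ˡ (parts m) μ↭)

  N = j + sum (map odd ks)

  n≡ : n ≡ weight m + N
  n≡ = trans (sym sum≡n) (trans (sum-↭ ps↭′)
    (trans (sum-++ (parts m) _) (cong (weight m +_) (sum-fill j (map odd ks)))))

  result : _
  result with c , source≡ , size≤ , size≤n ←
    smallCode-exists n>3 (oddMarker regular m∈ ps↭) (m+n≤o⇒m≤o _ (≤-reflexive (sym n≡))) =
    (qs , marker) ,
    (((sort-↗ (inserted marker ++ ν) , positive , sum-qs) , qs-regular) ,
      ∈markers (Linked⇒Sorted (sort-↗ (inserted marker ++ ν))) qs-regular qs↭) ,
    match {ones = j} {k} {ks} sorted sum≡n (trans (sym source≡) (cong source (sym code≡))) ps↭′ qs↭
    where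
    -- The unit saved in `sum-nonTriple` pays for a code one larger than the weight.
    room : sum (map nonTriple ks) ≤ n ∸ size c
    room = begin
      sum (map nonTriple ks)    ≤⟨ sum-nonTriple ks ⟩
      pred (sum (map odd ks))   ≤⟨ pred-mono-≤ (m≤n+m _ j) ⟩
      pred N                    ≡⟨ cong pred (m+n∸m≡n (weight m) N) ⟨
      pred (weight m + N ∸ weight m)  ≡⟨ cong (λ t → pred (t ∸ weight m)) n≡ ⟨
      pred (n ∸ weight m)       ≡⟨ pred[m∸n]≡m∸[1+n] n (weight m) ⟩
      n ∸ suc (weight m)        ≤⟨ ∸-monoʳ-≤ n size≤ ⟩
      n ∸ size c                ∎
      where open ≤-Reasoning

    -- The number of 1s that brings the new partition up to sum `n`.
    k = n ∸ size c ∸ sum (map nonTriple ks)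
    ν = fill k (map nonTriple ks)
    placement = place c ν
    open Placement placement
    qs = sort (inserted marker ++ ν)

    qs↭ : qs ↭ inserted marker ++ ν
    qs↭ = sort-↭ (inserted marker ++ ν)

    sum-qs : sum qs ≡ n
    sum-qs = begin
      sum qs                                    ≡⟨ sum-↭ qs↭ ⟩
      sum (inserted marker ++ ν)                ≡⟨ sum-++ (inserted marker) ν ⟩
      sum (inserted marker) + sum ν             ≡⟨ cong₂ _+_ (Placement.sum≡ placement)
                                                          (sum-fill k (map nonTriple ks)) ⟩
      size c + (k + sum (map nonTriple ks))     ≡⟨ cong (size c +_) (m∸n+n≡m room) ⟩
      size c + (n ∸ size c)                     ≡⟨ m+[n∸m]≡n size≤n ⟩
      n                                         ∎
      where open ≡-Reasoning

    ν-regular : IsRegular 3 ν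
    ν-regular = All.++⁺ (All.replicate⁺ k (3∤1+i*3 0)) (All.map⁺ (All.universal 3∤nonTriple ks))

    qs-regular : IsRegular 3 qs
    qs-regular = All-resp-↭ (↭-sym qs↭) (All.++⁺ (Placement.regular placement) ν-regular)

    positive : All (_> 0) qs
    positive = All.map (λ 3∤p → n≢0⇒n>0 λ { refl → 3∤p (3 ∣0) }) qs-regular

-- Comparing the two hook counts.

hooks : ℕ → ℕ → List (List ℕ × Marker)
hooks t n = tagged markers (regularPartitions t n)

b≡length-hooks : ∀ n t → b t 2 n ≡ length (hooks t n)
b≡length-hooks n t = length-tagged markers length-markers (regularPartitions t n)

hooks-unique : ∀ n → Unique (hooks 2 n)
hooks-unique n = tagged-unique markers (regularPartitions-unique 2 n) λ ps∈ →
  markers-unique (Linked⇒Sorted (proj₁ (proj₁ (∈-regularPartitions⁻ 2 n ps∈))))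

match-total : ∀ n → n > 3 → ∀ {x} → x ∈ hooks 2 n →
              ∃ λ y → y ∈ hooks 3 n × Match n x y
match-total n n>3 x∈ =
  let ps∈ , m∈ = ∈-tagged⁻ markers {xs = regularPartitions 2 n} x∈
      y , (regular , m′∈) , matched = match-exists n>3 (∈-regularPartitions⁻ 2 n ps∈) m∈
  in y , ∈-tagged⁺ markers (∈-regularPartitions⁺ 3 n regular) m′∈ , matched

theorem1p2 : ∀ (n : ℕ) → n > 3 → b 3 2 n ≥ b 2 2 n
theorem1p2 n n>3 = begin
  b 2 2 n             ≡⟨ b≡length-hooks n 2 ⟩
  length (hooks 2 n)  ≤⟨ length-≤-injective (Match n) match-injective
                           (hooks-unique n) (match-total n n>3) ⟩
  length (hooks 3 n)  ≡⟨ b≡length-hooks n 3 ⟨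
  b 3 2 n             ∎
  where open ≤-Reasoning
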